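{- Let $(t_j^i)_{0\le j\le i}$ be real numbers and let $h_{j,k}^i$ ($0\le k\le i$, $0\le j\le i-k$) be defined by $h_{j,0}^i=t_j^i$ and $h_{j,k}^i=h_{j,k-1}^{i-1}+h_{j,k-1}^{i}+h_{j+1,k-1}^{i}$ for $k\ge 1$. Then for any $0\leq k \leq i$, $0\leq j \leq i-k$, $$h^i_{j,k}=\sum_{r=0}^{k} \sum_{s=0}^{r} \binom{k}{s,\,k-r,\,r-s} t_{j+s}^{i-k+r}.$$
   Context: For non-negative integers $p,q,r$ with $p+q+r=n$, the tetrahedron trinomial coefficient is $\binom{n}{p,q,r}=\frac{n!}{p!\,q!\,r!}$. The numbers $t_j^i$ ($i,j\in\mathbb N$, $0\le j\le i$) form an arithmetical triangle $\mathcal T$ (rows $i$, columns $j$), and the $h_{j,k}^i$ form a tetrahedron $\mathcal H$ with face $\mathcal T$. -}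

module Defs where

open import Algebra.Bundles using (CommutativeRing)
open import Data.Nat.Base using (ℕ; zero; suc; _≤_; s≤s; s≤s⁻¹; _*_; _∸_; _/_; _!)
open import Data.Nat.Properties using (_!≢0; _!*_!≢0; m*n≢0; ≤-trans; ≤-reflexive; m≤n⇒m≤1+n; ∸-monoˡ-≤; n≤1+n; +-∸-assoc)
open import Relation.Binary.PropositionalEquality using (sym)

-- Meant for p + q + r ≡ n; the truncating division of ℕ is then exact.
trinomial : (n p q r : ℕ) → ℕ
trinomial n p q r = (n ! / (p ! * q ! * r !)) {{m*n≢0 (p ! * q !) (r !) {{p !* q !≢0}} {{r !≢0}}}}

module Tetrahedron {c ℓ} (R : CommutativeRing c ℓ) where

  private module R = CommutativeRing R
  open R using (Carrier)

  open import Algebra.Properties.Semiring.Sum R.semiring using (sum⁺-syntax) public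
  -- n × x is the n-fold sum x + ⋯ + x, i.e. the product of x by the integer n.
  open import Algebra.Properties.Semiring.Mult R.semiring using (_×_) public

  -- t i j _ is the entry in row i and column j.  The range proof is irrelevant,
  -- so an entry depends on its indices only.
  Triangle : Set c
  Triangle = (i j : ℕ) → .(j ≤ i) → Carrier

  h : Triangle → (i j k : ℕ) → .(k ≤ i) → .(j ≤ i ∸ k) → Carrier
  h t i       j zero    _   j≤ = t i j j≤
  h t (suc i) j (suc k) k≤i j≤ =
        h t i j k (s≤s⁻¹ k≤i) j≤
    R.+ h t (suc i) j k (m≤n⇒m≤1+n (s≤s⁻¹ k≤i)) (≤-trans j≤ (∸-monoˡ-≤ k (n≤1+n i)))
    R.+ h t (suc i) (suc j) k (m≤n⇒m≤1+n (s≤s⁻¹ k≤i)) (≤-trans (s≤s j≤) (≤-reflexive (sym (+-∸-assoc 1 (s≤s⁻¹ k≤i)))))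

{-# OPTIONS --safe #-}

-- Put d = i − k.  In the coordinates (d, j) the recurrence reads
-- H_{k+1} = (1 + A (1 + B)) H_k, where A shifts d and B shifts j, so that
-- H_k = Σ_r C(k,r) A^r (1 + B)^r t = Σ_r C(k,r) A^r Σ_s C(r,s) B^s t,
-- and C(k,r) C(r,s) is the trinomial coefficient.
module Submission where

open import Defs
open import Algebra.Bundles using (CommutativeMonoid; CommutativeRing)
open import Data.Nat.Base using (ℕ; zero; suc; _≤_; _+_; _*_; _∸_; _!; s≤s; s≤s⁻¹)
open import Data.Nat.Combinatorics using (_C_; nCk≡n!/k![n-k]!; k![n∸k]!∣n!; k>n⇒nCk≡0; nCk+nC[k+1]≡[n+1]C[k+1])
open import Data.Nat.DivMod using (m*n/n≡m; m/n*n≡m; /-congˡ)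
open import Data.Nat.Properties using (+-mono-≤; +-suc; +-identityʳ; +-∸-assoc; _≤?_; _!≢0; _!*_!≢0; m*n≢0; n<1+n; m≤n⇒m≤1+n; ≤-trans; ≤-reflexive; *-zeroʳ)
open import Data.Nat.Solver using (module +-*-Solver)
open import Data.Fin.Base using (toℕ; inject₁; fromℕ) renaming (suc to fsuc)
open import Data.Fin.Properties using (toℕ≤pred[n]; toℕ-inject₁; toℕ-fromℕ)
open import Data.Vec.Functional using (Vector)
open import Function.Base using (_∘_)
open import Relation.Binary.PropositionalEquality as ≡ using (_≡_; cong; cong₂)
open import Relation.Nullary using (yes; no; contradiction)

nCk*[k!*[n∸k]!]≡n! : ∀ {n k} → k ≤ n → (n C k) * (k ! * (n ∸ k) !) ≡ n !
nCk*[k!*[n∸k]!]≡n! {n} {k} k≤n = ≡.trans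
  (cong (_* (k ! * (n ∸ k) !)) (nCk≡n!/k![n-k]! k≤n))
  (m/n*n≡m {{k !* (n ∸ k) !≢0}} (k![n∸k]!∣n! k≤n))

-- Expanding `k !` by `k C r` and then the factor `r !` by `r C s` leaves exactly the denominator of
-- the trinomial. The truncating division is therefore exact.
trinomial≡C*C : ∀ {k r s} → r ≤ k → s ≤ r → trinomial k s (k ∸ r) (r ∸ s) ≡ (k C r) * (r C s)
trinomial≡C*C {k} {r} {s} r≤k s≤r =
  ≡.trans (/-congˡ k!≡) (m*n/n≡m ((k C r) * (r C s)) (s ! * (k ∸ r) ! * (r ∸ s) !))
  where
  open ≡.≡-Reasoning
  instance _ = m*n≢0 (s ! * (k ∸ r) !) ((r ∸ s) !) {{s !* (k ∸ r) !≢0}} {{(r ∸ s) !≢0}}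

  k!≡ : k ! ≡ (k C r) * (r C s) * (s ! * (k ∸ r) ! * (r ∸ s) !)
  k!≡ = begin
    k !                                                   ≡⟨ nCk*[k!*[n∸k]!]≡n! r≤k ⟨
    (k C r) * (r ! * (k ∸ r) !)                             ≡⟨ cong (λ x → (k C r) * (x * (k ∸ r) !)) (nCk*[k!*[n∸k]!]≡n! s≤r) ⟨
    (k C r) * ((r C s) * (s ! * (r ∸ s) !) * (k ∸ r) !)       ≡⟨ solve 5 (λ a b x y z → a :* (b :* (x :* y) :* z) := a :* b :* (x :* z :* y)) ≡.refl (k C r) (r C s) (s !) ((r ∸ s) !) ((k ∸ r) !) ⟩
    (k C r) * (r C s) * (s ! * (k ∸ r) ! * (r ∸ s) !)         ∎
    where open +-*-Solver

module BinomialSum {c ℓ} (M : CommutativeMonoid c ℓ) where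

  open CommutativeMonoid M renaming (_∙_ to _⊕_; ε to 0#; ∙-cong to ⊕-cong; ∙-congˡ to ⊕-congˡ; assoc to ⊕-assoc; comm to ⊕-comm; identityʳ to ⊕-identityʳ)
  open import Algebra.Properties.CommutativeMonoid.Sum M
  open import Algebra.Properties.CommutativeMonoid.Mult M
  open import Algebra.Properties.CommutativeSemigroup commutativeSemigroup using (x∙yz≈y∙xz)
  open import Relation.Binary.Reasoning.Setoid setoid

  ×-distribˡ-sum : ∀ {n} m (xs : Vector Carrier n) → m × sum xs ≈ ∑[ i < n ] (m × xs i)
  ×-distribˡ-sum {zero}  m xs = ×-zeroʳ m
    where
    ×-zeroʳ : ∀ m → m × 0# ≈ 0#
    -- Here `0#` is read as `0 × 0#`, so the two multiples merge into `(m * 0) × 0#`.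
    ×-zeroʳ m = trans (×-assocˡ 0# m 0) (×-congˡ (*-zeroʳ m))
  ×-distribˡ-sum {suc n} m xs = trans (×-distrib-+ _ _ m) (⊕-congˡ (×-distribˡ-sum m (xs ∘ fsuc)))

  -- This is `(1 + E)^n f` evaluated at `0`, where `E` is the shift `f ↦ f ∘ suc`.
  binomialSum : ℕ → (ℕ → Carrier) → Carrier
  binomialSum n f = ∑[ r ≤ n ] ((n C toℕ r) × f (toℕ r))

  binomialSum-cong : ∀ n {f g : ℕ → Carrier} → (∀ r → f r ≈ g r) → binomialSum n f ≈ binomialSum n g
  binomialSum-cong n f≈g = sum-cong-≋ {suc n} λ r → ×-congʳ (n C toℕ r) (f≈g (toℕ r))

  binomialSum-⊕ : ∀ n f g → binomialSum n (λ r → f r ⊕ g r) ≈ binomialSum n f ⊕ binomialSum n g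
  binomialSum-⊕ n f g = begin
    binomialSum n (λ r → f r ⊕ g r)
      ≈⟨ sum-cong-≋ {suc n} (λ r → ×-distrib-+ (f (toℕ r)) (g (toℕ r)) (n C toℕ r)) ⟩
    ∑[ r ≤ n ] ((n C toℕ r) × f (toℕ r) ⊕ (n C toℕ r) × g (toℕ r))
      ≈⟨ ∑-distrib-+ {suc n} (λ r → (n C toℕ r) × f (toℕ r)) (λ r → (n C toℕ r) × g (toℕ r)) ⟩
    binomialSum n f ⊕ binomialSum n g ∎

  binomialSum-zero : ∀ f → binomialSum 0 f ≈ f 0
  binomialSum-zero f = trans (⊕-identityʳ _) (×-homo-1 (f 0))

  -- The extra index `suc n` carries the coefficient `n C suc n`, which is zero.
  binomialSum-extend : ∀ n f → ∑[ r ≤ suc n ] ((n C toℕ r) × f (toℕ r)) ≈ binomialSum n f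
  binomialSum-extend n f = begin
    ∑[ r ≤ suc n ] x (toℕ r)
      ≈⟨ sum-init-last {suc n} (x ∘ toℕ) ⟩
    ∑[ r ≤ n ] x (toℕ (inject₁ r)) ⊕ x (toℕ (fromℕ (suc n)))
      ≈⟨ ⊕-cong (sum-cong-≋ {suc n} λ r → reflexive (cong x (toℕ-inject₁ r))) last≈0 ⟩
    binomialSum n f ⊕ 0#
      ≈⟨ ⊕-identityʳ _ ⟩
    binomialSum n f ∎
    where
    x : ℕ → Carrier
    x r = (n C r) × f r

    last≈0 : x (toℕ (fromℕ (suc n))) ≈ 0#
    last≈0 = trans (reflexive (cong x (toℕ-fromℕ (suc n)))) (×-congˡ (k>n⇒nCk≡0 (n<1+n n)))

  -- Pascal's rule, in operator form `(1 + E)^(n+1) = (1 + E)^n + (1 + E)^n E`.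
  binomialSum-suc : ∀ n f → binomialSum (suc n) f ≈ binomialSum n f ⊕ binomialSum n (f ∘ suc)
  binomialSum-suc n f = begin
    1 × f 0 ⊕ ∑[ r ≤ n ] ((suc n C suc (toℕ r)) × f (suc (toℕ r)))
      ≈⟨ ⊕-congˡ (sum-cong-≋ {suc n} λ r → trans
           (×-congˡ (≡.sym (nCk+nC[k+1]≡[n+1]C[k+1] n (toℕ r))))
           (×-homo-+ (f (suc (toℕ r))) (n C toℕ r) (n C suc (toℕ r)))) ⟩
    1 × f 0 ⊕ ∑[ r ≤ n ] ((n C toℕ r) × f (suc (toℕ r)) ⊕ (n C suc (toℕ r)) × f (suc (toℕ r)))
      ≈⟨ ⊕-congˡ (∑-distrib-+ {suc n} (λ r → (n C toℕ r) × f (suc (toℕ r))) (λ r → (n C suc (toℕ r)) × f (suc (toℕ r)))) ⟩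
    1 × f 0 ⊕ (binomialSum n (f ∘ suc) ⊕ ∑[ r ≤ n ] ((n C suc (toℕ r)) × f (suc (toℕ r))))
      -- Since `n C 0` computes to `1`, the term `1 × f 0` is the missing `r = 0` term of the second
      -- sum, whose range thereby becomes `0` to `suc n`.
      ≈⟨ x∙yz≈y∙xz _ _ _ ⟩
    binomialSum n (f ∘ suc) ⊕ ∑[ r ≤ suc n ] ((n C toℕ r) × f (toℕ r))
      ≈⟨ ⊕-congˡ (binomialSum-extend n f) ⟩
    binomialSum n (f ∘ suc) ⊕ binomialSum n f
      ≈⟨ ⊕-comm _ _ ⟩
    binomialSum n f ⊕ binomialSum n (f ∘ suc) ∎

  -- The closed form of `H_k` at `(d, j)`, with the two binomials kept apart so that Pascal's rule
  -- applies to each. `T` is total, so no range proofs enter the sums.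
  trinomialSum : (ℕ → ℕ → Carrier) → (k d j : ℕ) → Carrier
  trinomialSum T k d j = binomialSum k λ r → binomialSum r λ s → T (d + r) (j + s)

  trinomialSum-zero : ∀ T d j → trinomialSum T 0 d j ≈ T d j
  trinomialSum-zero T d j = begin
    trinomialSum T 0 d j                  ≈⟨ binomialSum-zero (λ r → binomialSum r λ s → T (d + r) (j + s)) ⟩
    binomialSum 0 (λ s → T (d + 0) (j + s)) ≈⟨ binomialSum-zero (λ s → T (d + 0) (j + s)) ⟩
    T (d + 0) (j + 0)                     ≡⟨ cong₂ T (+-identityʳ d) (+-identityʳ j) ⟩
    T d j                                 ∎

  -- Pascal's rule in `r` splits off the unshifted sum; in the remaining one, Pascal's rule in `s`
  -- gives the two sums at `suc d`. This is the recurrence of `h`.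
  trinomialSum-suc : ∀ T k d j → trinomialSum T (suc k) d j ≈
    trinomialSum T k d j ⊕ trinomialSum T k (suc d) j ⊕ trinomialSum T k (suc d) (suc j)
  trinomialSum-suc T k d j = begin
    binomialSum (suc k) (λ r → row r (d + r) j)
      ≈⟨ binomialSum-suc k (λ r → row r (d + r) j) ⟩
    trinomialSum T k d j ⊕ binomialSum k (λ r → row (suc r) (d + suc r) j)
      ≈⟨ ⊕-congˡ (binomialSum-cong k row-suc) ⟩
    trinomialSum T k d j ⊕ binomialSum k (λ r → row r (suc d + r) j ⊕ row r (suc d + r) (suc j))
      ≈⟨ ⊕-congˡ (binomialSum-⊕ k (λ r → row r (suc d + r) j) (λ r → row r (suc d + r) (suc j))) ⟩
    trinomialSum T k d j ⊕ (trinomialSum T k (suc d) j ⊕ trinomialSum T k (suc d) (suc j))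
      ≈⟨ ⊕-assoc _ _ _ ⟨
    trinomialSum T k d j ⊕ trinomialSum T k (suc d) j ⊕ trinomialSum T k (suc d) (suc j) ∎
    where
    row : ℕ → ℕ → ℕ → Carrier
    row r e j = binomialSum r λ s → T e (j + s)

    -- Raising `r` moves the row by `A` and also raises the power of `1 + B`; the extra factor
    -- `1 + B` yields the two summands.
    row-suc : ∀ r → row (suc r) (d + suc r) j ≈ row r (suc d + r) j ⊕ row r (suc d + r) (suc j)
    row-suc r = begin
      row (suc r) (d + suc r) j
        ≡⟨ cong (λ e → row (suc r) e j) (+-suc d r) ⟩
      row (suc r) (suc d + r) j
        ≈⟨ binomialSum-suc r (λ s → T (suc d + r) (j + s)) ⟩
      row r (suc d + r) j ⊕ binomialSum r (λ s → T (suc d + r) (j + suc s))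
        ≈⟨ ⊕-congˡ (binomialSum-cong r λ s → reflexive (cong (T (suc d + r)) (+-suc j s))) ⟩
      row r (suc d + r) j ⊕ row r (suc d + r) (suc j) ∎

  -- Distributing the outer coefficient over the inner sum makes it meet the inner one. The bounds
  -- `s ≤ r ≤ k` that `trinomial≡C*C` requires come from the `Fin` indices.
  trinomialSum≈∑∑ : ∀ T k d j → trinomialSum T k d j ≈
    ∑[ r ≤ k ] (∑[ s ≤ toℕ r ]
      (trinomial k (toℕ s) (k ∸ toℕ r) (toℕ r ∸ toℕ s) × T (d + toℕ r) (j + toℕ s)))
  trinomialSum≈∑∑ T k d j = sum-cong-≋ {suc k} λ r → begin
    (k C toℕ r) × binomialSum (toℕ r) (λ s → T (d + toℕ r) (j + s))
      ≈⟨ ×-distribˡ-sum {suc (toℕ r)} (k C toℕ r) (λ s → (toℕ r C toℕ s) × T (d + toℕ r) (j + toℕ s)) ⟩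
    ∑[ s ≤ toℕ r ] ((k C toℕ r) × ((toℕ r C toℕ s) × T (d + toℕ r) (j + toℕ s)))
      ≈⟨ sum-cong-≋ {suc (toℕ r)} (λ s → trans
           (×-assocˡ (T (d + toℕ r) (j + toℕ s)) (k C toℕ r) (toℕ r C toℕ s))
           (×-congˡ (≡.sym (trinomial≡C*C (toℕ≤pred[n] r) (toℕ≤pred[n] s))))) ⟩
    ∑[ s ≤ toℕ r ]
      (trinomial k (toℕ s) (k ∸ toℕ r) (toℕ r ∸ toℕ s) × T (d + toℕ r) (j + toℕ s)) ∎

module _ {c ℓ} (R : CommutativeRing c ℓ) where

  open CommutativeRing R using (Carrier; _≈_; 0#; +-commutativeMonoid; +-cong; reflexive; sym; trans)
  open Tetrahedron R
  open BinomialSum +-commutativeMonoid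

  -- Makes the triangle total. The value `0#` is only a filler: each entry met in the final sum has
  -- `j + s ≤ i ∸ k + r`.
  extendByZero : Triangle → ℕ → ℕ → Carrier
  extendByZero t i j with j ≤? i
  ... | yes j≤i = t i j j≤i
  ... | no  _   = 0#

  extendByZero-≤ : ∀ t {i j} (j≤i : j ≤ i) → extendByZero t i j ≡ t i j j≤i
  extendByZero-≤ t {i} {j} j≤i with j ≤? i
  -- The proof found by the decision may differ from `j≤i`, but `t` takes it irrelevantly.
  ... | yes _   = ≡.refl
  ... | no  j≰i = contradiction j≤i j≰i

  -- Induction along the recursion of `h`. Lowering both `i` and `k` keeps `d = i ∸ k`, while
  -- lowering `k` alone raises it by one, which matches `trinomialSum-suc`.
  h≈trinomialSum : ∀ t i j k (k≤i : k ≤ i) (j≤i∸k : j ≤ i ∸ k) →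
    h t i j k k≤i j≤i∸k ≈ trinomialSum (extendByZero t) k (i ∸ k) j
  h≈trinomialSum t i       j zero    _   j≤i = trans
    (reflexive (≡.sym (extendByZero-≤ t j≤i)))
    (sym (trinomialSum-zero (extendByZero t) i j))
  h≈trinomialSum t (suc i) j (suc k) k<i j≤i∸k = trans
    (+-cong (+-cong
      (h≈trinomialSum t i j k k≤i j≤i∸k)
      (next j (m≤n⇒m≤1+n j≤i∸k)))
      (next (suc j) (s≤s j≤i∸k)))
    (sym (trinomialSum-suc (extendByZero t) k (i ∸ k) j))
    where
    k≤i : k ≤ i
    k≤i = s≤s⁻¹ k<i

    1+i∸k≡ : suc i ∸ k ≡ suc (i ∸ k)
    1+i∸k≡ = +-∸-assoc 1 k≤i

    -- Serves both neighbours in row `suc i`, where `suc i ∸ k` equals `suc (i ∸ k)` only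
    -- propositionally and has to be rewritten.
    next : ∀ j (j≤ : j ≤ suc (i ∸ k)) →
      h t (suc i) j k (m≤n⇒m≤1+n k≤i) (≤-trans j≤ (≤-reflexive (≡.sym 1+i∸k≡)))
        ≈ trinomialSum (extendByZero t) k (suc (i ∸ k)) j
    next j j≤ = trans
      (h≈trinomialSum t (suc i) j k (m≤n⇒m≤1+n k≤i) (≤-trans j≤ (≤-reflexive (≡.sym 1+i∸k≡))))
      (reflexive (cong (λ d → trinomialSum (extendByZero t) k d j) 1+i∸k≡))

theorem1 : ∀ {c ℓ} (R : CommutativeRing c ℓ) →
    let open CommutativeRing R using (_≈_)
        open Tetrahedron R
    in ∀ (t : Triangle) i j k (k≤i : k ≤ i) (j≤i∸k : j ≤ i ∸ k) →
       h t i j k k≤i j≤i∸k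
         ≈ ∑[ r ≤ k ] (∑[ s ≤ toℕ r ]
             (trinomial k (toℕ s) (k ∸ toℕ r) (toℕ r ∸ toℕ s)
               × t (i ∸ k + toℕ r) (j + toℕ s) (+-mono-≤ j≤i∸k (toℕ≤pred[n] s))))
theorem1 R t i j k k≤i j≤i∸k = trans (h≈trinomialSum R t i j k k≤i j≤i∸k)
  (trans (trinomialSum≈∑∑ (extendByZero R t) k (i ∸ k) j)
    -- Adding `s ≤ r` to `j ≤ i ∸ k` puts every index inside the triangle, so the extension agrees
    -- with `t` term by term.
    (sum-cong-≋ {suc k} λ r → sum-cong-≋ {suc (toℕ r)} λ s →
      ×-congʳ (trinomial k (toℕ s) (k ∸ toℕ r) (toℕ r ∸ toℕ s))
        (reflexive (extendByZero-≤ R t (+-mono-≤ j≤i∸k (toℕ≤pred[n] s))))))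
  where
  open CommutativeRing R using (+-commutativeMonoid; reflexive; trans)
  open BinomialSum +-commutativeMonoid
  open import Algebra.Properties.CommutativeMonoid.Sum +-commutativeMonoid using (sum-cong-≋)
  open import Algebra.Properties.CommutativeMonoid.Mult +-commutativeMonoid using (×-congʳ)
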